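{- For every derivation in $\mathsf{SKS}$ with premise $T$ and conclusion $R$ there are structures $V$ and $U$ and a derivation from $T$ to $R$ composed, from top to bottom, of: a derivation from $T$ to $V$ in $\{ai{\downarrow}\}$, a derivation from $V$ to $U$ in $\mathsf{SKS}\setminus\{ai{\downarrow},ai{\uparrow}\}$, and a derivation from $U$ to $R$ in $\{ai{\uparrow}\}$.
   Context: Structures: generated by $S ::= \mathsf f \mid \mathsf t \mid a \mid [S,\dots,S] \mid (S,\dots,S) \mid \bar S$ (non-empty lists), where $a$ ranges over atoms, $\mathsf f,\mathsf t$ are the units false and true, $[\cdot]$ is disjunction, $(\cdot)$ is conjunction, $\bar S$ is negation; the negation of an atom is again an atom. A context $S\{\ \}$ is a structure with one occurrence of a hole, not in the scope of a negation; $S\{R\}$ is the result of filling it with $R$; $S[R,T]$ abbreviates $S\{[R,T]\}$ and $S(R,T)$ abbreviates $S\{(R,T)\}$. Equivalent structures are not distinguished; equivalence is the smallest equivalence relation induced by: $[\vec R,[\vec T],\vec U]=[\vec R,\vec T,\vec U]$ and $(\vec R,(\vec T),\vec U)=(\vec R,\vec T,\vec U)$ (with $\vec R,\vec T,\vec U$ finite sequences, $\vec T$ non-empty); $[R,T]=[T,R]$, $(R,T)=(T,R)$; $(\mathsf f,\mathsf f)=\mathsf f$, $[\mathsf f,R]=R$, $[\mathsf t,\mathsf t]=\mathsf t$, $(\mathsf t,R)=R$; $\bar{\mathsf f}=\mathsf t$, $\bar{\mathsf t}=\mathsf f$, $\overline{[R,T]}=(\bar R,\bar T)$, $\overline{(R,T)}=[\bar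 R,\bar T]$, $\bar{\bar R}=R$; and closure: if $R=T$ then $S\{R\}=S\{T\}$ and $\bar R=\bar T$. A derivation in a system (set of inference rules) is a finite sequence of rule instances, read top-down, the conclusion of each being the premise of the next; it may consist of a single structure. Its premise is the topmost structure, its conclusion the bottommost. System $\mathsf{SKS}$ has the rules (written $\frac{\text{premise}}{\text{conclusion}}$, for atoms $a$, structures $R,T,U,V$ and contexts $S\{\ \}$): $ai{\downarrow}:\frac{S\{\mathsf t\}}{S[a,\bar a]}$, $ai{\uparrow}:\frac{S(a,\bar a)}{S\{\mathsf f\}}$, $s:\frac{S([R,U],T)}{S[(R,T),U]}$, $m:\frac{S[(R,U),(T,V)]}{S([R,T],[U,V])}$, $aw{\downarrow}:\frac{S\{\mathsf f\}}{S\{a\}}$, $aw{\uparrow}:\frac{S\{a\}}{S\{\mathsf t\}}$, $ac{\downarrow}:\frac{S[a,a]}{S\{a\}}$, $ac{\uparrow}:\frac{S\{a\}}{S(a,a)}$. -}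

module Defs where

open import Algebra.Definitions using (Involutive)
open import Data.List.Base using (List; []; _∷_)
open import Data.List.NonEmpty.Base using (List⁺; _∷_; _++⁺_; _⁺++_)
open import Level using (0ℓ)
open import Relation.Binary.PropositionalEquality using (_≡_)
open import Relation.Unary using (Pred; _∈_; U)

-- Any set of atoms on which negation restricts to an involution.
record Atoms : Set₁ where
  field
    Atom           : Set
    neg            : Atom → Atom
    neg-involutive : Involutive _≡_ neg

module Calculus (𝔸 : Atoms) where
  open Atoms 𝔸 public

  infix  20 ∼_
  infixr 15 _∧_
  infixr 14 _∨_
  infix  10 _⟦_⟧
  infix  4  _≈_ _—[_]→_

  -- ⋁ is the disjunction [S,…,S] and ⋀ the conjunction (S,…,S).
  data Structure : Set where
    ff tt : Structure
    atom  : Atom → Structure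
    ⋁ ⋀   : List⁺ Structure → Structure
    ∼_    : Structure → Structure

  _∨_ _∧_ : Structure → Structure → Structure
  R ∨ T = ⋁ (R ∷ T ∷ [])
  R ∧ T = ⋀ (R ∷ T ∷ [])

  -- There is no constructor for negation: the hole is never in its scope.
  data Context : Set where
    ○     : Context
    ⋁-ctx : List Structure → Context → List Structure → Context
    ⋀-ctx : List Structure → Context → List Structure → Context

  _⟦_⟧ : Context → Structure → Structure
  ○              ⟦ R ⟧ = R
  (⋁-ctx Rs S Us) ⟦ R ⟧ = ⋁ (Rs ++⁺ (S ⟦ R ⟧ ∷ Us))
  (⋀-ctx Rs S Us) ⟦ R ⟧ = ⋀ (Rs ++⁺ (S ⟦ R ⟧ ∷ Us))

  data _≈_ : Structure → Structure → Set where
    ≈-refl  : ∀ {R} → R ≈ R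
    ≈-sym   : ∀ {R T} → R ≈ T → T ≈ R
    ≈-trans : ∀ {R T V} → R ≈ T → T ≈ V → R ≈ V

    ∨-assoc : ∀ Rs Ts Us → ⋁ (Rs ++⁺ (⋁ Ts ∷ Us)) ≈ ⋁ (Rs ++⁺ (Ts ⁺++ Us))
    ∧-assoc : ∀ Rs Ts Us → ⋀ (Rs ++⁺ (⋀ Ts ∷ Us)) ≈ ⋀ (Rs ++⁺ (Ts ⁺++ Us))

    ∨-comm  : ∀ R T → R ∨ T ≈ T ∨ R
    ∧-comm  : ∀ R T → R ∧ T ≈ T ∧ R

    ff∧ff   : ff ∧ ff ≈ ff
    ff∨     : ∀ R → ff ∨ R ≈ R
    tt∨tt   : tt ∨ tt ≈ tt
    tt∧     : ∀ R → tt ∧ R ≈ R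

    ∼-ff    : ∼ ff ≈ tt
    ∼-tt    : ∼ tt ≈ ff
    -- Identifies the structural negation of an atom with the atom it denotes.
    ∼-atom  : ∀ a → ∼ atom a ≈ atom (neg a)
    ∼-∨     : ∀ R T → ∼ (R ∨ T) ≈ ∼ R ∧ ∼ T
    ∼-∧     : ∀ R T → ∼ (R ∧ T) ≈ ∼ R ∨ ∼ T
    ∼-∼     : ∀ R → ∼ ∼ R ≈ R

    ⟦⟧-cong : ∀ S {R T} → R ≈ T → S ⟦ R ⟧ ≈ S ⟦ T ⟧
    ∼-cong  : ∀ {R T} → R ≈ T → ∼ R ≈ ∼ T

  data Rule : Set where
    ai↓ ai↑ s m aw↓ aw↑ ac↓ ac↑ : Rule

  -- P —[ ρ ]→ C : an instance of ρ with premise P and conclusion C.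
  data _—[_]→_ : Structure → Rule → Structure → Set where
    ai↓-inst : ∀ S a       → S ⟦ tt ⟧                    —[ ai↓ ]→ S ⟦ atom a ∨ ∼ atom a ⟧
    ai↑-inst : ∀ S a       → S ⟦ atom a ∧ ∼ atom a ⟧     —[ ai↑ ]→ S ⟦ ff ⟧
    s-inst   : ∀ S R T U   → S ⟦ (R ∨ U) ∧ T ⟧           —[ s   ]→ S ⟦ (R ∧ T) ∨ U ⟧
    m-inst   : ∀ S R T U V → S ⟦ (R ∧ U) ∨ (T ∧ V) ⟧     —[ m   ]→ S ⟦ (R ∨ T) ∧ (U ∨ V) ⟧
    aw↓-inst : ∀ S a       → S ⟦ ff ⟧                    —[ aw↓ ]→ S ⟦ atom a ⟧
    aw↑-inst : ∀ S a       → S ⟦ atom a ⟧                —[ aw↑ ]→ S ⟦ tt ⟧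
    ac↓-inst : ∀ S a       → S ⟦ atom a ∨ atom a ⟧       —[ ac↓ ]→ S ⟦ atom a ⟧
    ac↑-inst : ∀ S a       → S ⟦ atom a ⟧                —[ ac↑ ]→ S ⟦ atom a ∧ atom a ⟧

  System : Set₁
  System = Pred Rule 0ℓ

  SKS : System
  SKS = U

  -- Derivation 𝒮 T R has premise T and conclusion R.  As equivalent structures
  -- are not distinguished, consecutive structures need only match up to _≈_.
  data Derivation (𝒮 : System) : Structure → Structure → Set where
    single : ∀ {T R} → T ≈ R → Derivation 𝒮 T R
    step   : ∀ {T P C R ρ} → T ≈ P → ρ ∈ 𝒮 → P —[ ρ ]→ C →
             Derivation 𝒮 C R → Derivation 𝒮 T R

{-# OPTIONS --safe #-}

-- An interaction need not take place where it occurs: the switch rule alone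
-- moves a conjunct into a context, (X, S{R}) → S(X, R), and a disjunct out of
-- it, S[X, R] → [X, S{R}].  So the identities [a, ā] can be created next to the
-- premise and carried to the places where t is to be replaced by them, and the
-- cuts (a, ā) can be moved out and collected next to the conclusion.  Hence
-- a derivation from T to R yields one without interactions from (X, T) to
-- [Y, R], where t → X uses only ai↓ and Y → f only ai↑.
module Submission where

open import Defs
open import Data.List.Base using (List; []; _∷_; _++_)
open import Data.List.NonEmpty.Base using (List⁺; _∷_; _++⁺_; _⁺++_; toList)
open import Data.List.Properties using (++-identityʳ)
open import Data.Product using (_×_; _,_; ∃₂)
open import Data.Sum using (_⊎_; inj₁; inj₂)
open import Data.Unit using () renaming (tt to ⋆)
open import Level using (0ℓ)
open import Relation.Binary.Bundles using (Preorder; Setoid)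
open import Relation.Binary.PropositionalEquality using (_≡_; refl; cong; subst₂)
open import Relation.Unary using (_∈_; ｛_｝; _∪_; _∖_)
import Relation.Binary.Reasoning.Preorder as PreorderReasoning
import Relation.Binary.Reasoning.Setoid as SetoidReasoning

module _ (𝔸 : Atoms) where
  open Calculus 𝔸

  ≈-setoid : Setoid 0ℓ 0ℓ
  ≈-setoid = record
    { Carrier       = Structure
    ; _≈_           = _≈_
    ; isEquivalence = record { refl = ≈-refl ; sym = ≈-sym ; trans = ≈-trans }
    }

  -- Disjunction with `ff` and conjunction with `tt` satisfy the same laws of a commutative monoid
  -- on lists, so the rearrangements are proved once for both.
  module Connective
    (⨀      : List⁺ Structure → Structure)
    (ε      : Structure)
    (assoc  : ∀ Rs Ts Us → ⨀ (Rs ++⁺ (⨀ Ts ∷ Us)) ≈ ⨀ (Rs ++⁺ (Ts ⁺++ Us)))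
    (comm   : ∀ R T → ⨀ (R ∷ T ∷ []) ≈ ⨀ (T ∷ R ∷ []))
    (unitˡ  : ∀ R → ⨀ (ε ∷ R ∷ []) ≈ R)
    (⨀-cong : ∀ Rs Us {R T} → R ≈ T → ⨀ (Rs ++⁺ (R ∷ Us)) ≈ ⨀ (Rs ++⁺ (T ∷ Us)))
    where
    open SetoidReasoning ≈-setoid

    infixr 15 _∙_
    _∙_ : Structure → Structure → Structure
    R ∙ T = ⨀ (R ∷ T ∷ [])

    ∙-congˡ : ∀ {R T U} → T ≈ U → R ∙ T ≈ R ∙ U
    ∙-congˡ = ⨀-cong (_ ∷ []) []

    ∙-congʳ : ∀ {R T U} → R ≈ T → R ∙ U ≈ T ∙ U
    ∙-congʳ = ⨀-cong [] (_ ∷ [])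

    unitʳ : ∀ R → R ∙ ε ≈ R
    unitʳ R = ≈-trans (comm R ε) (unitˡ R)

    ∙-assoc : ∀ R T U → (R ∙ T) ∙ U ≈ R ∙ (T ∙ U)
    ∙-assoc R T U = ≈-trans (assoc [] (R ∷ T ∷ []) (U ∷ []))
                            (≈-sym (assoc (R ∷ []) (T ∷ U ∷ []) []))

    cons : ∀ R Ts → ⨀ (R ∷ toList Ts) ≈ R ∙ ⨀ Ts
    cons R Ts = begin
      ⨀ (R ∷ toList Ts)         ≡⟨ cong (λ Us → ⨀ (R ∷ Us)) (++-identityʳ (toList Ts)) ⟨
      ⨀ (R ∷ (toList Ts ++ [])) ≈⟨ assoc (R ∷ []) Ts [] ⟨
      R ∙ ⨀ Ts                  ∎

    -- Lists under a connective are non-empty, while `Rs` and `Us` may both be empty; the unit at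
    -- the head of `Us` covers that case.
    others : List Structure → List Structure → Structure
    others []       Us = ⨀ (ε ∷ Us)
    others (R ∷ Rs) Us = R ∙ others Rs Us

    extract : ∀ Rs Us {T} → ⨀ (Rs ++⁺ (T ∷ Us)) ≈ T ∙ others Rs Us
    extract [] Us {T} = begin
      -- Expanding `T` to `T ∙ ε` supplies the unit with which `others` begins.
      ⨀ (T ∷ Us)       ≈⟨ ⨀-cong [] Us (unitʳ T) ⟨
      ⨀ ((T ∙ ε) ∷ Us) ≈⟨ assoc [] (T ∷ ε ∷ []) Us ⟩
      ⨀ (T ∷ ε ∷ Us)   ≈⟨ cons T (ε ∷ Us) ⟩
      T ∙ ⨀ (ε ∷ Us)   ∎
    extract (R ∷ Rs) Us {T} = begin
      ⨀ ((R ∷ Rs) ++⁺ (T ∷ Us)) ≈⟨ cons R (Rs ++⁺ (T ∷ Us)) ⟩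
      R ∙ ⨀ (Rs ++⁺ (T ∷ Us))   ≈⟨ ∙-congˡ (extract Rs Us) ⟩
      R ∙ (T ∙ others Rs Us)    ≈⟨ ∙-assoc R T _ ⟨
      (R ∙ T) ∙ others Rs Us    ≈⟨ ∙-congʳ (comm R T) ⟩
      (T ∙ R) ∙ others Rs Us    ≈⟨ ∙-assoc T R _ ⟩
      T ∙ (R ∙ others Rs Us)    ∎

    extract-∙ : ∀ Rs Us {T W} → ⨀ (Rs ++⁺ ((T ∙ W) ∷ Us)) ≈ T ∙ ⨀ (Rs ++⁺ (W ∷ Us))
    extract-∙ Rs Us {T} {W} = begin
      ⨀ (Rs ++⁺ ((T ∙ W) ∷ Us)) ≈⟨ extract Rs Us ⟩
      (T ∙ W) ∙ others Rs Us    ≈⟨ ∙-assoc T W _ ⟩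
      T ∙ (W ∙ others Rs Us)    ≈⟨ ∙-congˡ (extract Rs Us) ⟨
      T ∙ ⨀ (Rs ++⁺ (W ∷ Us))   ∎

  module ∨ = Connective ⋁ ff ∨-assoc ∨-comm ff∨ (λ Rs Us → ⟦⟧-cong (⋁-ctx Rs ○ Us))
  module ∧ = Connective ⋀ tt ∧-assoc ∧-comm tt∧ (λ Rs Us → ⟦⟧-cong (⋀-ctx Rs ○ Us))

  infixr 9 _⊚_
  _⊚_ : Context → Context → Context
  ○              ⊚ S′ = S′
  ⋁-ctx Rs S Us ⊚ S′ = ⋁-ctx Rs (S ⊚ S′) Us
  ⋀-ctx Rs S Us ⊚ S′ = ⋀-ctx Rs (S ⊚ S′) Us

  ⟦⟧-⊚ : ∀ S S′ R → (S ⊚ S′) ⟦ R ⟧ ≡ S ⟦ S′ ⟦ R ⟧ ⟧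
  ⟦⟧-⊚ ○               S′ R = refl
  ⟦⟧-⊚ (⋁-ctx Rs S Us) S′ R = cong (λ T → ⋁ (Rs ++⁺ (T ∷ Us))) (⟦⟧-⊚ S S′ R)
  ⟦⟧-⊚ (⋀-ctx Rs S Us) S′ R = cong (λ T → ⋀ (Rs ++⁺ (T ∷ Us))) (⟦⟧-⊚ S S′ R)

  -- Every instance carries its own context, so an outer one is absorbed by composition. The
  -- composite agrees with nested filling only up to a propositional equality, hence the transport.
  instance-⟦⟧ : ∀ {ρ P C} S → P —[ ρ ]→ C → S ⟦ P ⟧ —[ ρ ]→ S ⟦ C ⟧
  instance-⟦⟧ S (ai↓-inst S′ a)     = subst₂ _—[ _ ]→_ (⟦⟧-⊚ S S′ _) (⟦⟧-⊚ S S′ _) (ai↓-inst (S ⊚ S′) a)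
  instance-⟦⟧ S (ai↑-inst S′ a)     = subst₂ _—[ _ ]→_ (⟦⟧-⊚ S S′ _) (⟦⟧-⊚ S S′ _) (ai↑-inst (S ⊚ S′) a)
  instance-⟦⟧ S (s-inst S′ R T U)   = subst₂ _—[ _ ]→_ (⟦⟧-⊚ S S′ _) (⟦⟧-⊚ S S′ _) (s-inst (S ⊚ S′) R T U)
  instance-⟦⟧ S (m-inst S′ R T U V) = subst₂ _—[ _ ]→_ (⟦⟧-⊚ S S′ _) (⟦⟧-⊚ S S′ _) (m-inst (S ⊚ S′) R T U V)
  instance-⟦⟧ S (aw↓-inst S′ a)     = subst₂ _—[ _ ]→_ (⟦⟧-⊚ S S′ _) (⟦⟧-⊚ S S′ _) (aw↓-inst (S ⊚ S′) a)
  instance-⟦⟧ S (aw↑-inst S′ a)     = subst₂ _—[ _ ]→_ (⟦⟧-⊚ S S′ _) (⟦⟧-⊚ S S′ _) (aw↑-inst (S ⊚ S′) a)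
  instance-⟦⟧ S (ac↓-inst S′ a)     = subst₂ _—[ _ ]→_ (⟦⟧-⊚ S S′ _) (⟦⟧-⊚ S S′ _) (ac↓-inst (S ⊚ S′) a)
  instance-⟦⟧ S (ac↑-inst S′ a)     = subst₂ _—[ _ ]→_ (⟦⟧-⊚ S S′ _) (⟦⟧-⊚ S S′ _) (ac↑-inst (S ⊚ S′) a)

  derivation-⟦⟧ : ∀ {𝒮 T R} S → Derivation 𝒮 T R → Derivation 𝒮 (S ⟦ T ⟧) (S ⟦ R ⟧)
  derivation-⟦⟧ S (single T≈R)       = single (⟦⟧-cong S T≈R)
  derivation-⟦⟧ S (step T≈P ρ∈𝒮 i d) =
    step (⟦⟧-cong S T≈P) ρ∈𝒮 (instance-⟦⟧ S i) (derivation-⟦⟧ S d)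

  infixr 5 _⨾_
  _⨾_ : ∀ {𝒮 T V R} → Derivation 𝒮 T V → Derivation 𝒮 V R → Derivation 𝒮 T R
  single T≈V       ⨾ single V≈R       = single (≈-trans T≈V V≈R)
  single T≈V       ⨾ step V≈P ρ∈𝒮 i d = step (≈-trans T≈V V≈P) ρ∈𝒮 i d
  step T≈P ρ∈𝒮 i d ⨾ e                = step T≈P ρ∈𝒮 i (d ⨾ e)

  rule : ∀ {𝒮 ρ P C} → ρ ∈ 𝒮 → P —[ ρ ]→ C → Derivation 𝒮 P C
  rule ρ∈𝒮 i = step ≈-refl ρ∈𝒮 i (single ≈-refl)

  derivation-preorder : System → Preorder 0ℓ 0ℓ 0ℓ
  derivation-preorder 𝒮 = record
    { Carrier    = Structure
    ; _≈_        = _≈_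
    ; _≲_        = Derivation 𝒮
    ; isPreorder = record
      { isEquivalence = Setoid.isEquivalence ≈-setoid
      ; reflexive     = single
      ; trans         = _⨾_
      }
    }

  Core : System
  Core = SKS ∖ (｛ ai↓ ｝ ∪ ｛ ai↑ ｝)

  s∈Core : s ∈ Core
  s∈Core = ⋆ , λ { (inj₁ ()) ; (inj₂ ()) }

  -- This split lets `separate` treat the six non-interaction rules in a single case.
  interaction⊎core : ∀ ρ → (ρ ≡ ai↓ ⊎ ρ ≡ ai↑) ⊎ ρ ∈ Core
  interaction⊎core ai↓ = inj₁ (inj₁ refl)
  interaction⊎core ai↑ = inj₁ (inj₂ refl)
  interaction⊎core s   = inj₂ s∈Core
  interaction⊎core m   = inj₂ (⋆ , λ { (inj₁ ()) ; (inj₂ ()) })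
  interaction⊎core aw↓ = inj₂ (⋆ , λ { (inj₁ ()) ; (inj₂ ()) })
  interaction⊎core aw↑ = inj₂ (⋆ , λ { (inj₁ ()) ; (inj₂ ()) })
  interaction⊎core ac↓ = inj₂ (⋆ , λ { (inj₁ ()) ; (inj₂ ()) })
  interaction⊎core ac↑ = inj₂ (⋆ , λ { (inj₁ ()) ; (inj₂ ()) })

  open PreorderReasoning (derivation-preorder Core)

  switch : ∀ R T U → Derivation Core ((R ∨ U) ∧ T) ((R ∧ T) ∨ U)
  switch R T U = rule s∈Core (s-inst ○ R T U)

  -- Induction on `S`, from the outside in. At a disjunction, the switch takes `X` to the disjunct
  -- with the hole and leaves the other disjuncts behind; at a conjunction, associativity and
  -- commutativity suffice.
  push-∧ : ∀ X S R → Derivation Core (X ∧ (S ⟦ R ⟧)) (S ⟦ X ∧ R ⟧)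
  push-∧ X ○ R = single ≈-refl
  push-∧ X (⋁-ctx Rs S Us) R = begin
    X ∧ ⋁ (Rs ++⁺ (S ⟦ R ⟧ ∷ Us))     ≈⟨ ∧-comm _ _ ⟩
    ⋁ (Rs ++⁺ (S ⟦ R ⟧ ∷ Us)) ∧ X     ≈⟨ ∧.∙-congʳ (∨.extract Rs Us) ⟩
    ((S ⟦ R ⟧) ∨ ∨.others Rs Us) ∧ X  ≲⟨ switch _ _ _ ⟩
    ((S ⟦ R ⟧) ∧ X) ∨ ∨.others Rs Us  ≈⟨ ∨.extract Rs Us ⟨
    ⋁ (Rs ++⁺ (((S ⟦ R ⟧) ∧ X) ∷ Us)) ≈⟨ ⟦⟧-cong (⋁-ctx Rs ○ Us) (∧-comm _ _) ⟩
    ⋁ (Rs ++⁺ ((X ∧ (S ⟦ R ⟧)) ∷ Us)) ≲⟨ derivation-⟦⟧ (⋁-ctx Rs ○ Us) (push-∧ X S R) ⟩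
    ⋁ (Rs ++⁺ (S ⟦ X ∧ R ⟧ ∷ Us))     ∎
  push-∧ X (⋀-ctx Rs S Us) R = begin
    X ∧ ⋀ (Rs ++⁺ (S ⟦ R ⟧ ∷ Us))     ≈⟨ ∧.extract-∙ Rs Us ⟨
    ⋀ (Rs ++⁺ ((X ∧ (S ⟦ R ⟧)) ∷ Us)) ≲⟨ derivation-⟦⟧ (⋀-ctx Rs ○ Us) (push-∧ X S R) ⟩
    ⋀ (Rs ++⁺ (S ⟦ X ∧ R ⟧ ∷ Us))     ∎

  -- Dual to `push-∧`: `X` leaves from the inside out, so the induction hypothesis is applied first,
  -- and the switch is needed at conjunctions instead.
  pull-∨ : ∀ X S R → Derivation Core (S ⟦ X ∨ R ⟧) (X ∨ (S ⟦ R ⟧))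
  pull-∨ X ○ R = single ≈-refl
  pull-∨ X (⋁-ctx Rs S Us) R = begin
    ⋁ (Rs ++⁺ (S ⟦ X ∨ R ⟧ ∷ Us))     ≲⟨ derivation-⟦⟧ (⋁-ctx Rs ○ Us) (pull-∨ X S R) ⟩
    ⋁ (Rs ++⁺ ((X ∨ (S ⟦ R ⟧)) ∷ Us)) ≈⟨ ∨.extract-∙ Rs Us ⟩
    X ∨ ⋁ (Rs ++⁺ (S ⟦ R ⟧ ∷ Us))     ∎
  pull-∨ X (⋀-ctx Rs S Us) R = begin
    ⋀ (Rs ++⁺ (S ⟦ X ∨ R ⟧ ∷ Us))     ≲⟨ derivation-⟦⟧ (⋀-ctx Rs ○ Us) (pull-∨ X S R) ⟩
    ⋀ (Rs ++⁺ ((X ∨ (S ⟦ R ⟧)) ∷ Us)) ≈⟨ ⟦⟧-cong (⋀-ctx Rs ○ Us) (∨-comm _ _) ⟩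
    ⋀ (Rs ++⁺ (((S ⟦ R ⟧) ∨ X) ∷ Us)) ≈⟨ ∧.extract Rs Us ⟩
    ((S ⟦ R ⟧) ∨ X) ∧ ∧.others Rs Us  ≲⟨ switch _ _ _ ⟩
    ((S ⟦ R ⟧) ∧ ∧.others Rs Us) ∨ X  ≈⟨ ∨.∙-congʳ (∧.extract Rs Us) ⟨
    ⋀ (Rs ++⁺ (S ⟦ R ⟧ ∷ Us)) ∨ X     ≈⟨ ∨-comm _ _ ⟩
    X ∨ ⋀ (Rs ++⁺ (S ⟦ R ⟧ ∷ Us))     ∎

  -- At the hole `X` meets `tt`, the unit of conjunction, and so takes its place. With an identity
  -- for `X`, this simulates `ai↓`.
  apply-∧ : ∀ X S → Derivation Core (X ∧ (S ⟦ tt ⟧)) (S ⟦ X ⟧)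
  apply-∧ X S = push-∧ X S tt ⨾ single (⟦⟧-cong S (∧.unitʳ X))

  collect-∨ : ∀ X S → Derivation Core (S ⟦ X ⟧) (X ∨ (S ⟦ ff ⟧))
  collect-∨ X S = single (⟦⟧-cong S (≈-sym (∨.unitʳ X))) ⨾ pull-∨ X S ff

  -- Induction on the derivation, adding its topmost instance to the result for the rest. `X` and
  -- `Y` are tied to the units rather than to `T` and `R`, so they can grow while the premise
  -- changes.
  separate : ∀ {T R} → Derivation SKS T R →
             ∃₂ λ X Y → Derivation ｛ ai↓ ｝ tt X
                      × Derivation Core (X ∧ T) (Y ∨ R)
                      × Derivation ｛ ai↑ ｝ Y ff
  separate {T} {R} (single T≈R) =
    tt , ff , single ≈-refl , single (≈-trans (tt∧ T) (≈-trans T≈R (≈-sym (ff∨ R)))) , single ≈-refl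
  separate {T} {R} (step {P = P} {C = C} {ρ = ρ} T≈P _ i d)
    with separate d | interaction⊎core ρ
  ... | X , Y , tt→X , X∧C→Y∨R , Y→ff | inj₂ ρ∈Core =
    X , Y , tt→X , X∧T→Y∨R , Y→ff
    where
    X∧T→Y∨R = begin
      X ∧ T ≈⟨ ∧.∙-congˡ T≈P ⟩
      X ∧ P ≲⟨ derivation-⟦⟧ (⋀-ctx (X ∷ []) ○ []) (rule ρ∈Core i) ⟩
      X ∧ C ≲⟨ X∧C→Y∨R ⟩
      Y ∨ R ∎
  separate {T} {R} (step T≈P _ (ai↓-inst S a) d)
      | X , Y , tt→X , X∧C→Y∨R , Y→ff | inj₁ (inj₁ refl) =
    X ∧ W , Y , tt→X∧W , X∧W∧T→Y∨R , Y→ff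
    where
    W = atom a ∨ ∼ atom a
    tt→X∧W : Derivation ｛ ai↓ ｝ tt (X ∧ W)
    -- The unit law provides a fresh `tt` beside `X` for the new identity.
    tt→X∧W = tt→X ⨾ step (≈-sym (∧.unitʳ X)) refl (ai↓-inst (⋀-ctx (X ∷ []) ○ []) a) (single ≈-refl)
    X∧W∧T→Y∨R = begin
      (X ∧ W) ∧ T          ≈⟨ ∧.∙-congˡ T≈P ⟩
      (X ∧ W) ∧ (S ⟦ tt ⟧) ≈⟨ ∧.∙-assoc X W _ ⟩
      X ∧ (W ∧ (S ⟦ tt ⟧)) ≲⟨ derivation-⟦⟧ (⋀-ctx (X ∷ []) ○ []) (apply-∧ W S) ⟩
      X ∧ (S ⟦ W ⟧)        ≲⟨ X∧C→Y∨R ⟩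
      Y ∨ R                ∎
  separate {T} {R} (step T≈P _ (ai↑-inst S a) d)
      | X , Y , tt→X , X∧C→Y∨R , Y→ff | inj₁ (inj₂ refl) =
    X , W ∨ Y , tt→X , X∧T→W∨Y∨R , W∨Y→ff
    where
    W = atom a ∧ ∼ atom a
    W∨Y→ff : Derivation ｛ ai↑ ｝ (W ∨ Y) ff
    W∨Y→ff = rule refl (ai↑-inst (⋁-ctx [] ○ (Y ∷ [])) a) ⨾ single (ff∨ Y) ⨾ Y→ff
    X∧T→W∨Y∨R = begin
      X ∧ T                ≈⟨ ∧.∙-congˡ T≈P ⟩
      -- The context includes the conjunct `X`, so `W` ends up outside the whole premise `X ∧ C` of
      -- the remaining derivation, which then runs beside `W`.
      X ∧ (S ⟦ W ⟧)        ≲⟨ collect-∨ W (⋀-ctx (X ∷ []) S []) ⟩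
      W ∨ (X ∧ (S ⟦ ff ⟧)) ≲⟨ derivation-⟦⟧ (⋁-ctx (W ∷ []) ○ []) X∧C→Y∨R ⟩
      W ∨ (Y ∨ R)          ≈⟨ ∨.∙-assoc W Y R ⟨
      (W ∨ Y) ∨ R          ∎

theorem3p31 : (𝔸 : Atoms) → let open Calculus 𝔸 in
    ∀ T R → Derivation SKS T R →
    ∃₂ λ V U → Derivation ｛ ai↓ ｝ T V
    × Derivation (SKS ∖ (｛ ai↓ ｝ ∪ ｛ ai↑ ｝)) V U
    × Derivation ｛ ai↑ ｝ U R
theorem3p31 𝔸 T R d with separate 𝔸 d
... | X , Y , tt→X , X∧T→Y∨R , Y→ff =
  -- The unit laws make room for `X` beside `T` at the top and let the `ff` obtained from `Y` vanish
  -- beside `R` at the bottom.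
  X ∧ T , Y ∨ R ,
  _⨾_ 𝔸 (single (≈-sym (tt∧ T))) (derivation-⟦⟧ 𝔸 (⋀-ctx [] ○ (T ∷ [])) tt→X) ,
  X∧T→Y∨R ,
  _⨾_ 𝔸 (derivation-⟦⟧ 𝔸 (⋁-ctx [] ○ (R ∷ [])) Y→ff) (single (ff∨ R))
  where open Calculus 𝔸
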